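{- For every $d \in \{2,3,4,5,8,12,16\}$, there are at most finitely many positive integers $n$ for which $\left\lfloor n^2/d \right\rfloor$ is prime. -}

module Defs where

open import Data.List using (List)
open import Data.List.Membership.Propositional using (_∈_)
open import Data.Product using (∃)
open import Function.Bundles using (_⇔_)
open import Level using (Level; _⊔_)
open import Relation.Unary using (Pred)

private
  variable
    a p : Level

-- Repetitions in the list are allowed, so this says that the subset of A cut
-- out by P is finite (possibly empty).
FinitelyMany : {A : Set a} → Pred A p → Set (a ⊔ p)
FinitelyMany {A = A} P = ∃ λ (xs : List A) → ∀ x → P x ⇔ x ∈ xs

{-# OPTIONS --safe #-}

-- The listed d are such that every square is congruent modulo d to some s² < d.
-- For such d, if p = ⌊n²/d⌋ is prime, then n² = d p + s² with s < d, so with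
-- n = s + k we get k (k + 2 s) = d p.  As p divides one of the factors,
-- p ≤ k + 2 s, hence k ≤ d and n < 2 d.

module Submission where

open import Defs
open import Data.Fin using (Fin; toℕ; fromℕ<)
import Data.Fin.Properties as Fin
open import Data.List using ([]; _∷_; filter; upTo)
open import Data.List.Membership.Propositional using (_∈_)
open import Data.List.Membership.Propositional.Properties using (∈-filter⁺; ∈-filter⁻; ∈-upTo⁺)
open import Data.List.Relation.Unary.Any using (here; there)
open import Data.Nat using (ℕ; suc; _+_; _*_; _∸_; _^_; _/_; _%_; _≤_; _<_; _≥_; _≤?_; _≟_; z≤n; NonZero)
open import Data.Nat.Divisibility using (divides; ∣⇒≤)
open import Data.Nat.DivMod using (m≡m%n+[m/n]*n; m%n≤m; %-distribˡ-*; m%n<n)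
open import Data.Nat.Primality using (Prime; prime?; euclidsLemma)
open import Data.Nat.Properties using (*-identityʳ; *-comm; *-cancelʳ-≤; *-monoʳ-≤; +-cancelˡ-≡; +-mono-<-≤; ^-monoˡ-<; <⇒≱; ≮⇒≥; ≤-trans; m≤m+n; m+[n∸m]≡n; module ≤-Reasoning)
open import Data.Nat.Tactic.RingSolver using (solve-∀)
open import Data.Product using (_×_; _,_; ∃; proj₂)
open import Data.Sum using (inj₁; inj₂)
open import Function.Bundles using (mk⇔)
open import Relation.Binary.PropositionalEquality using (_≡_; refl; trans; cong; subst; module ≡-Reasoning)
open import Relation.Nullary using (Dec)
open import Relation.Nullary.Decidable using (_×-dec_; from-yes)
open import Relation.Unary using (Pred; Decidable)

-- `FinitelyMany` asks for a list holding exactly the solutions, so a bound alone is not enough: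
-- decidability of `P` lets `filter` pick them out of `upTo b`.
bounded⇒finitelyMany : ∀ {p} {P : Pred ℕ p} → Decidable P → ∀ b → (∀ n → P n → n < b) → FinitelyMany P
bounded⇒finitelyMany P? b P⇒<b = filter P? (upTo b) , λ n →
  mk⇔ (λ Pn → ∈-filter⁺ P? (∈-upTo⁺ (P⇒<b n Pn)) Pn)
      (λ n∈ → proj₂ (∈-filter⁻ P? {xs = upTo b} n∈))

-- Both `r` and `s` range over `Fin d`, which makes the property decidable by finite search. The
-- bound `s < d` also enters the final estimate on `n`.
SquareResidues : (d : ℕ) .{{_ : NonZero d}} → Set
SquareResidues d = ∀ (r : Fin d) → ∃ λ (s : Fin d) → (toℕ r ^ 2) % d ≡ toℕ s ^ 2

squareResidues? : ∀ d .{{_ : NonZero d}} → Dec (SquareResidues d)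
squareResidues? d = Fin.all? λ r → Fin.any? λ s → (toℕ r ^ 2) % d ≟ toℕ s ^ 2

m^2≡m*m : ∀ m → m ^ 2 ≡ m * m
m^2≡m*m m = cong (m *_) (*-identityʳ m)

m^2%d≡[m%d]^2%d : ∀ m d .{{_ : NonZero d}} → (m ^ 2) % d ≡ ((m % d) ^ 2) % d
m^2%d≡[m%d]^2%d m d = begin
  (m ^ 2) % d              ≡⟨ cong (_% d) (m^2≡m*m m) ⟩
  (m * m) % d              ≡⟨ %-distribˡ-* m m d ⟩
  (m % d * (m % d)) % d    ≡⟨ cong (_% d) (m^2≡m*m (m % d)) ⟨
  ((m % d) ^ 2) % d        ∎
  where open ≡-Reasoning

m^2%d-square : ∀ d .{{_ : NonZero d}} → SquareResidues d → ∀ m → ∃ λ (s : Fin d) → (m ^ 2) % d ≡ toℕ s ^ 2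
m^2%d-square d sq m with sq (fromℕ< (m%n<n m d))
-- The rewrite turns the index `fromℕ< _` back into `m % d`, whose square has the same residue as
-- `m ^ 2`.
... | s , eq rewrite Fin.toℕ-fromℕ< (m%n<n m d) = s , trans (m^2%d≡[m%d]^2%d m d) eq

m^2≤n^2⇒m≤n : ∀ {m n} → m ^ 2 ≤ n ^ 2 → m ≤ n
m^2≤n^2⇒m≤n m²≤n² = ≮⇒≥ λ n<m → <⇒≱ (^-monoˡ-< 2 n<m) m²≤n²

[m+n]^2-expand : ∀ m n → (m + n) ^ 2 ≡ m ^ 2 + n * (n + (m + m))
[m+n]^2-expand = unfolded
  where
  -- The ring solver rejects literal exponents; m ^ 2 reduces to m * (m * 1).
  unfolded : ∀ m n → (m + n) * ((m + n) * 1) ≡ m * (m * 1) + n * (n + (m + m))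
  unfolded = solve-∀

-- By Euclid's lemma `p` divides `k` or `k + m`. For positive `k` either case gives `p ≤ k + m`, and
-- this factor cancels from `k * (k + m) ≤ d * (k + m)`.
k*[k+m]≡d*p⇒k≤d : ∀ {d p} → Prime p → ∀ k m → k * (k + m) ≡ d * p → k ≤ d
-- Here `p` divides `k` trivially, which says nothing about its size.
k*[k+m]≡d*p⇒k≤d _ 0 m _ = z≤n
k*[k+m]≡d*p⇒k≤d {d} {p} prime-p k@(suc _) m eq = *-cancelʳ-≤ k d (k + m) (begin
  k * (k + m)  ≡⟨ eq ⟩
  d * p        ≤⟨ *-monoʳ-≤ d p≤k+m ⟩
  d * (k + m)  ∎)
  where
  open ≤-Reasoning
  p≤k+m : p ≤ k + m
  p≤k+m with euclidsLemma k (k + m) prime-p (divides d eq)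
  ... | inj₁ p∣k   = ≤-trans (∣⇒≤ p∣k) (m≤m+n k m)
  ... | inj₂ p∣k+m = ∣⇒≤ p∣k+m

prime[n^2/d]⇒n<d+d : ∀ d .{{_ : NonZero d}} → SquareResidues d → ∀ n → Prime ((n ^ 2) / d) → n < d + d
prime[n^2/d]⇒n<d+d d sq n prime-p with m^2%d-square d sq n
... | i , n²%d≡s² = subst (_< d + d) s+k≡n (+-mono-<-≤ (Fin.toℕ<n i) (k*[k+m]≡d*p⇒k≤d prime-p k (s + s) factored))
  where
  open ≡-Reasoning
  s = toℕ i
  k = n ∸ s
  p = (n ^ 2) / d

  s+k≡n : s + k ≡ n
  -- The subtraction in `k` is not truncated: `s ^ 2` is a remainder of `n ^ 2`, so it is at most
  -- `n ^ 2`, and hence `s ≤ n`.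
  s+k≡n = m+[n∸m]≡n (m^2≤n^2⇒m≤n {s} {n} (subst (_≤ n ^ 2) n²%d≡s² (m%n≤m (n ^ 2) d)))

  factored : k * (k + (s + s)) ≡ d * p
  -- Both sides plus `s ^ 2` equal `n ^ 2`: one by expanding `(s + k) ^ 2`, the other by division
  -- with remainder.
  factored = +-cancelˡ-≡ (s ^ 2) _ _ (begin
    s ^ 2 + k * (k + (s + s))   ≡⟨ [m+n]^2-expand s k ⟨
    (s + k) ^ 2                 ≡⟨ cong (_^ 2) s+k≡n ⟩
    n ^ 2                       ≡⟨ m≡m%n+[m/n]*n (n ^ 2) d ⟩
    (n ^ 2) % d + p * d         ≡⟨ cong (_+ p * d) n²%d≡s² ⟩
    s ^ 2 + p * d               ≡⟨ cong (s ^ 2 +_) (*-comm p d) ⟩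
    s ^ 2 + d * p               ∎)

squareResidues⇒finitelyMany : ∀ d .{{_ : NonZero d}} → SquareResidues d → FinitelyMany (λ (n : ℕ) → n ≥ 1 × Prime ((n ^ 2) / d))
squareResidues⇒finitelyMany d sq = bounded⇒finitelyMany
  (λ n → 1 ≤? n ×-dec prime? ((n ^ 2) / d)) (d + d)
  (λ n (_ , prime-p) → prime[n^2/d]⇒n<d+d d sq n prime-p)

-- Matching on membership makes `d` a numeral, so the decision procedure evaluates to a proof during
-- type checking.
squareResidues : ∀ d .{{_ : NonZero d}} → d ∈ 2 ∷ 3 ∷ 4 ∷ 5 ∷ 8 ∷ 12 ∷ 16 ∷ [] → SquareResidues d
squareResidues _ (here refl) = from-yes (squareResidues? 2)
squareResidues _ (there (here refl)) = from-yes (squareResidues? 3)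
squareResidues _ (there (there (here refl))) = from-yes (squareResidues? 4)
squareResidues _ (there (there (there (here refl)))) = from-yes (squareResidues? 5)
squareResidues _ (there (there (there (there (here refl))))) = from-yes (squareResidues? 8)
squareResidues _ (there (there (there (there (there (here refl)))))) = from-yes (squareResidues? 12)
squareResidues _ (there (there (there (there (there (there (here refl))))))) = from-yes (squareResidues? 16)

theorem1 : ∀ (d : ℕ) .{{_ : NonZero d}} → d ∈ 2 ∷ 3 ∷ 4 ∷ 5 ∷ 8 ∷ 12 ∷ 16 ∷ [] → FinitelyMany (λ (n : ℕ) → n ≥ 1 × Prime ((n ^ 2) / d))
theorem1 d d∈ = squareResidues⇒finitelyMany d (squareResidues d d∈)
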